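{- For all integers $r,n\ge 0$ there is a bijection $\phi^{\mathrm{fix}}:D_n^*(r)\to W_n(r)$, $(w_0,(w_1,i_1),\dots,(w_m,i_m))\mapsto w$, such that $$i_1+\cdots+i_m=\mathrm{dec}\,w,\qquad i_1+\cdots+i_m+\mathrm{tot}\,w_0+\mathrm{tot}\,w_1+\cdots+\mathrm{tot}\,w_m=\mathrm{tot}\,w,\qquad \lambda w_0=\mathrm{single}\,w.$$
   Context: $W_n(r)=\{0,1,\dots,r\}^n$ is the set of words of length $n$ over $\{0,\dots,r\}$. For a word $c=c_1\cdots c_n$ of nonnegative integers, $\lambda c=n$ and $\mathrm{tot}\,c=c_1+\cdots+c_n$. $\mathrm{NIW}(r)$ is the set of nonincreasing words (any length $\ge0$) with letters in $\{0,\dots,r\}$. $D(r)$ is the set of pairs $(w,i)$ with $w\in\mathrm{NIW}(r-1)$, $\lambda w\ge2$, $1\le i\le\lambda w-1$. $D_n^*(r)$ is the set of sequences $(w_0,(w_1,i_1),\dots,(w_m,i_m))$, $m\ge0$, with $w_0\in\mathrm{NIW}(r)$, each $(w_j,i_j)\in D(r)$, and $\lambda w_0+\cdots+\lambda w_m=n$. Decreases: for $w=x_1\cdots x_n$, an index $i$ with $1\le i\le n-1$ is a decrease if $x_i\ge x_{i+1}\ge\cdots\ge x_j>x_{j+1}$ for some $j$ with $i\le j\le n-1$; $\mathrm{dec}\,w$ is the number of decreases. Lyndon factorization: a nonempty word $x_1\cdots x_n$ is Lyndon if $n=1$ or it is lexicographically strictly greater than each of its proper cyclic rotations $x_i\cdots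 x_nx_1\cdots x_{i-1}$, $2\le i\le n$. For primitive nonempty words, $w\preceq w'$ means $w^b\le w'^b$ lexicographically for all sufficiently large $b$. Every nonempty word factors uniquely as $l_1l_2\cdots l_k$ with Lyndon words $l_1\preceq l_2\preceq\cdots\preceq l_k$; $\mathrm{single}\,w$ is the number of factors $l_i$ of length one (and $\mathrm{single}$ of the empty word is $0$). -}

module Defs where

open import Data.Nat using (ℕ; zero; suc; _+_; _∸_; _≤_; _<_; _≥_; _<ᵇ_; _≤ᵇ_)
open import Data.Bool using (Bool; true; false; _∨_; _∧_; if_then_else_)
open import Data.Nat.ListAction using (sum)
open import Data.List using (List; []; _∷_; length; map; concat; replicate; drop; take; _++_; filter)
open import Data.List.Relation.Unary.All using (All)
open import Data.List.Relation.Unary.Linked using (Linked)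
open import Data.Product using (Σ; _×_; ∃)
open import Relation.Binary.PropositionalEquality using (_≡_)
open import Data.Sum using (_⊎_)

Word : Set
Word = List ℕ

len : Word → ℕ
len = length

tot : Word → ℕ
tot = sum

W : ℕ → ℕ → Set
W n r = Σ Word (λ w → len w ≡ n × All (_≤ r) w)

NIW : ℕ → Set
NIW r = Σ Word (λ w → All (_≤ r) w × Linked _≥_ w)

record DElt (r : ℕ) : Set where
  constructor delt
  field
    word    : Word
    letters : All (_< r) word
    nonincr : Linked _≥_ word
    len≥2   : 2 ≤ len word
    idx     : ℕ
    idx≥1   : 1 ≤ idx
    idx≤    : idx ≤ len word ∸ 1
open DElt public

Dstar : ℕ → ℕ → Set
Dstar n r = Σ (NIW r) (λ w₀ → Σ (List (DElt r)) (λ ds →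
              len (Σ.proj₁ w₀) + sum (map (λ d → len (word d)) ds) ≡ n))

-- decreases: index i is a decrease iff x_i ≥ x_{i+1} ≥ … ≥ x_j > x_{j+1}
-- for some j ≥ i.  startsDec s tests this for the suffix s = x_i x_{i+1} …
startsDec : Word → Bool
startsDec (x ∷ y ∷ rest) = (y <ᵇ x) ∨ ((y ≤ᵇ x) ∧ startsDec (y ∷ rest))
startsDec _ = false

dec : Word → ℕ
dec [] = 0
dec (x ∷ xs) = (if startsDec (x ∷ xs) then 1 else 0) + dec xs

data _<lex_ : Word → Word → Set where
  []<∷  : ∀ {y ys} → [] <lex (y ∷ ys)
  head< : ∀ {x y xs ys} → x < y → (x ∷ xs) <lex (y ∷ ys)
  tail< : ∀ {x xs ys} → xs <lex ys → (x ∷ xs) <lex (x ∷ ys)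

_≤lex_ : Word → Word → Set
u ≤lex v = u <lex v ⊎ u ≡ v

rotate : ℕ → Word → Word
rotate k w = drop k w ++ take k w

IsLyndon : Word → Set
IsLyndon w = 1 ≤ len w × (len w ≡ 1 ⊎ (∀ k → 1 ≤ k → k < len w → rotate k w <lex w))

power : Word → ℕ → Word
power w b = concat (replicate b w)

_⪯_ : Word → Word → Set
w ⪯ w' = ∃ λ B → ∀ b → B ≤ b → power w b ≤lex power w' b

IsLyndonFactorization : Word → List Word → Set
IsLyndonFactorization w fs = concat fs ≡ w × All IsLyndon fs × Linked _⪯_ fs

isSingleton : Word → Bool
isSingleton (_ ∷ []) = true
isSingleton _ = false

countSingles : List Word → ℕ
countSingles [] = 0
countSingles (f ∷ fs) = (if isSingleton f then 1 else 0) + countSingles fs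

-- "single w ≡ k": the (unique) Lyndon factorization of w has exactly k
-- factors of length one.  (For w empty, the empty factorization gives 0.)
SingleIs : Word → ℕ → Set
SingleIs w k = Σ (List Word) (λ fs → IsLyndonFactorization w fs × countSingles fs ≡ k)

{-# OPTIONS --safe #-}

-- The pair (w, i) is encoded as the V-word w₁+1 ≥ … ≥ wᵢ+1 > w_l ≤ … ≤ w_{i+1}, which has i decreases and total
-- i + tot w. Starting from w₀ in nondecreasing order, the V-words are inserted one after the other, each in front of
-- the longest nondecreasing suffix whose letters are at least its first letter. This adds i decreases, and the last
-- inserted V-word can be read off from the last run of decreases and the nondecreasing run behind it.
-- Singletons of the Lyndon factorization are exactly the letters that are at least all preceding ones
-- and are not decreases; an insertion creates and destroys none of these.
module Submission where

open import Defs
open import Data.Bool.Base using (Bool; true; false; not; _∨_; _∧_; if_then_else_)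
open import Data.Bool.Properties using (∧-zeroʳ)
open import Data.Empty using (⊥)
open import Data.List.Base using (List; []; _∷_; _++_; concat; length; drop; take; map; reverse)
open import Data.List.Properties using (++-assoc; ++-identityʳ; ∷-injective; length-++; length-reverse;
  reverse-injective; reverse-involutive; unfold-reverse)
open import Data.List.Relation.Binary.Permutation.Propositional using (↭-sym)
open import Data.List.Relation.Binary.Permutation.Propositional.Properties using (All-resp-↭; ↭-reverse)
open import Data.List.Relation.Unary.All as All using (All; []; _∷_)
open import Data.List.Relation.Unary.All.Properties using (++⁺; ++⁻; ++⁻ˡ)
open import Data.List.Relation.Unary.AllPairs as AllPairs using (AllPairs; []; _∷_; allPairs?)
open import Data.List.Relation.Unary.AllPairs.Properties using () renaming (++⁺ to AllPairs-++⁺)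
open import Data.List.Relation.Unary.Linked as Linked using (Linked; []; [-]; _∷_)
open import Data.List.Relation.Unary.Linked.Properties using (Linked⇒AllPairs; AllPairs⇒Linked)
open import Data.Nat.Base using (ℕ; zero; suc; _+_; _≤_; _<_; _≥_; _<ᵇ_; _≤ᵇ_; _⊔_; _∸_; z≤n; s≤s)
open import Data.Nat.ListAction using (sum)
open import Data.Nat.ListAction.Properties using (sum-++; sum-↭)
open import Data.Nat.Properties
open import Algebra.Properties.CommutativeSemigroup +-commutativeSemigroup using (x∙yz≈y∙xz)
open import Data.Nat.Tactic.RingSolver using (solve-∀)
open import Data.Product.Base using (Σ; ∃; ∃₂; _×_; _,_; proj₁; proj₂)
open import Data.Sum.Base using (_⊎_; inj₁; inj₂)
open import Function.Base using (flip)
open import Function.Bundles using (_⤖_; mk⤖; Bijection)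
open import Function.Consequences.Propositional using (strictlySurjective⇒surjective)
open import Relation.Binary.Definitions using (tri<; tri≈; tri>)
open import Relation.Binary.PropositionalEquality
  using (_≡_; refl; sym; trans; cong; cong₂; subst; module ≡-Reasoning)
open import Relation.Nullary using (Dec; yes; no; ¬_; contradiction)
open import Relation.Nullary.Decidable using (dec-true; dec-false)

private variable
  m n x y z a b i j r : ℕ
  s t u v w w′ w″ xs ys : Word

-- Decreases and counted records

startsDec-> : ∀ s → y < x → startsDec (x ∷ y ∷ s) ≡ true
startsDec-> {y} {x} s y<x rewrite dec-true (y <? x) y<x = refl

startsDec-< : ∀ s → x < y → startsDec (x ∷ y ∷ s) ≡ false
startsDec-< {x} {y} s x<y
  rewrite dec-false (y <? x) (<-asym x<y) | dec-false (y ≤? x) (<⇒≱ x<y) = refl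

startsDec-≡ : ∀ x s → startsDec (x ∷ x ∷ s) ≡ startsDec (x ∷ s)
startsDec-≡ x s
  rewrite dec-false (x <? x) (<-irrefl refl) | dec-true (x ≤? x) ≤-refl = refl

startsDec-≥ : ∀ s → y ≤ x → startsDec (y ∷ s) ≡ true → startsDec (x ∷ y ∷ s) ≡ true
startsDec-≥ {y} s y≤x e with m≤n⇒m<n∨m≡n y≤x
... | inj₁ y<x  = startsDec-> s y<x
... | inj₂ refl = trans (startsDec-≡ y s) e

-- The number of non-decreases x_i with x_i ≥ m and x_i ≥ x_1, …, x_{i-1}; for m = 0 this is single w.
records : ℕ → Word → ℕ
records m []       = 0
records m (x ∷ xs) = (if (m ≤ᵇ x) ∧ not (startsDec (x ∷ xs)) then 1 else 0) + records (m ⊔ x) xs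

records-skip : ∀ m x xs → x ≤ m → x < m ⊎ startsDec (x ∷ xs) ≡ true → records m (x ∷ xs) ≡ records m xs
records-skip m x xs x≤m (inj₁ x<m)
  rewrite dec-false (m ≤? x) (<⇒≱ x<m) | m≥n⇒m⊔n≡m x≤m = refl
records-skip m x xs x≤m (inj₂ e)
  rewrite e | ∧-zeroʳ (m ≤ᵇ x) | m≥n⇒m⊔n≡m x≤m = refl

records-dec : ∀ m x xs → startsDec (x ∷ xs) ≡ true → records m (x ∷ xs) ≡ records (m ⊔ x) xs
records-dec m x xs e rewrite e | ∧-zeroʳ (m ≤ᵇ x) = refl

records-¬dec : ∀ m x xs → m ≤ x → startsDec (x ∷ xs) ≡ false → records m (x ∷ xs) ≡ suc (records x xs)
records-¬dec m x xs m≤x e rewrite e | dec-true (m ≤? x) m≤x | m≤n⇒m⊔n≡n m≤x = refl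

-- Lyndon words

-- Without the prefix clause of the lexicographic order, ≪ survives extending both words on the right.
data _≪_ : Word → Word → Set where
  head≪ : x < y → (x ∷ xs) ≪ (y ∷ ys)
  tail≪ : xs ≪ ys → (x ∷ xs) ≪ (x ∷ ys)

≪⇒<lex : u ≪ v → u <lex v
≪⇒<lex (head≪ p) = head< p
≪⇒<lex (tail≪ p) = tail< (≪⇒<lex p)

≪-++ : ∀ s t → u ≪ v → (u ++ s) ≪ (v ++ t)
≪-++ s t (head≪ p) = head≪ p
≪-++ s t (tail≪ p) = tail≪ (≪-++ s t p)

≪-++ʳ : u ≪ v → u ≪ (v ++ t)
≪-++ʳ (head≪ p) = head≪ p
≪-++ʳ (tail≪ p) = tail≪ (≪-++ʳ p)

≪-prefix : ∀ w → u ≪ v → (w ++ u) ≪ (w ++ v)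
≪-prefix []      p = p
≪-prefix (x ∷ w) p = tail≪ (≪-prefix w p)

≪-trans : u ≪ v → v ≪ w → u ≪ w
≪-trans (head≪ p) (head≪ q) = head≪ (<-trans p q)
≪-trans (head≪ p) (tail≪ q) = head≪ p
≪-trans (tail≪ p) (head≪ q) = head≪ q
≪-trans (tail≪ p) (tail≪ q) = tail≪ (≪-trans p q)

≪-head : (x ∷ xs) ≪ (y ∷ ys) → x ≤ y
≪-head (head≪ p) = <⇒≤ p
≪-head (tail≪ p) = ≤-refl

_ProperPrefixOf_ : Word → Word → Set
u ProperPrefixOf v = ∃₂ λ z t → v ≡ u ++ z ∷ t

-- For distinct Lyndon words, ≼ agrees with ⪯.  A proper prefix counts as the larger word (211 ≼ 2), since power
-- comparison sets it against a smaller suffix; lexicographic order would do the opposite.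
_≼_ : Word → Word → Set
u ≼ v = u ≪ v ⊎ u ≡ v ⊎ v ProperPrefixOf u

_≻_ : Word → Word → Set
u ≻ v = v ≪ u ⊎ u ProperPrefixOf v

≼-or-≻ : ∀ u v → u ≼ v ⊎ u ≻ v
≼-or-≻ []      []      = inj₁ (inj₂ (inj₁ refl))
≼-or-≻ []      (y ∷ v) = inj₂ (inj₂ (y , v , refl))
≼-or-≻ (x ∷ u) []      = inj₁ (inj₂ (inj₂ (x , u , refl)))
≼-or-≻ (x ∷ u) (y ∷ v) with <-cmp x y
... | tri< x<y _ _ = inj₁ (inj₁ (head≪ x<y))
... | tri> _ _ y<x = inj₂ (inj₁ (head≪ y<x))
... | tri≈ _ refl _ with ≼-or-≻ u v
...   | inj₁ (inj₁ p)                     = inj₁ (inj₁ (tail≪ p))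
...   | inj₁ (inj₂ (inj₁ refl))           = inj₁ (inj₂ (inj₁ refl))
...   | inj₁ (inj₂ (inj₂ (z , t , refl))) = inj₁ (inj₂ (inj₂ (z , t , refl)))
...   | inj₂ (inj₁ p)                     = inj₂ (inj₁ (tail≪ p))
...   | inj₂ (inj₂ (z , t , refl))        = inj₂ (inj₂ (z , t , refl))

≼-head : (a ∷ s) ≼ (b ∷ t) → a ≤ b
≼-head (inj₁ p)                     = ≪-head p
≼-head (inj₂ (inj₁ refl))           = ≤-refl
≼-head (inj₂ (inj₂ (_ , _ , refl))) = ≤-refl

data Suffixes (P : Word → Set) : Word → Set where
  []  : Suffixes P []
  _∷_ : P (x ∷ xs) → Suffixes P xs → Suffixes P (x ∷ xs)

private variable
  P Q : Word → Set

Suffixes-map : (∀ {u} → P u → Q u) → Suffixes P s → Suffixes Q s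
Suffixes-map f []       = []
Suffixes-map f (p ∷ ps) = f p ∷ Suffixes-map f ps

Suffixes-++⁺ : (∀ {u} → P u → Q (u ++ t)) → Suffixes P s → Suffixes Q t → Suffixes Q (s ++ t)
Suffixes-++⁺ f []       qs = qs
Suffixes-++⁺ f (p ∷ ps) qs = f p ∷ Suffixes-++⁺ f ps qs

Suffixes-++⁻ : ∀ s → Suffixes P (s ++ t) → Suffixes P t
Suffixes-++⁻ []      ps       = ps
Suffixes-++⁻ (_ ∷ s) (_ ∷ ps) = Suffixes-++⁻ s ps

Suffixes-drop : ∀ k → k < length s → Suffixes P s → P (drop k s)
Suffixes-drop zero    _       (p ∷ _)  = p
Suffixes-drop (suc k) (s≤s l) (_ ∷ ps) = Suffixes-drop k l ps

-- Suffixes replace rotations: `≪` finds a smaller letter inside the suffix, so the letters that a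
-- rotation appends cannot change the comparison.
data Lyndon : Word → Set where
  lyndon : Suffixes (_≪ (a ∷ s)) s → Lyndon (a ∷ s)

Lyndon⇒IsLyndon : Lyndon w → IsLyndon w
Lyndon⇒IsLyndon {a ∷ s} (lyndon ps) = s≤s z≤n , inj₂ λ where
  (suc k) _ (s≤s k<) → ≪⇒<lex (subst (rotate (suc k) (a ∷ s) ≪_) (++-identityʳ _)
                         (≪-++ (take (suc k) (a ∷ s)) [] (Suffixes-drop k k< ps)))

-- Everything follows from `v ≪ (u ++ v)`: proper suffixes of `v` lie below `v`, and those of `u`
-- stay smaller when `v` is appended.
Lyndon-++ : Lyndon u → Lyndon v → u ≻ v → Lyndon (u ++ v)
Lyndon-++ {a ∷ s} {b ∷ t} (lyndon ps) (lyndon qs) u≻v =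
  lyndon (Suffixes-++⁺ (≪-++ _ _) ps (v≪uv u≻v qs ∷ Suffixes-map (λ p → ≪-trans p (v≪uv u≻v qs)) qs))
  where
  v≪uv : (a ∷ s) ≻ (b ∷ t) → Suffixes (_≪ (b ∷ t)) t → (b ∷ t) ≪ ((a ∷ s) ++ b ∷ t)
  v≪uv (inj₁ p) _ = ≪-++ʳ p
  -- Here `v` is `u` followed by `z ∷ z′`, a proper suffix of `v` and hence smaller than `v`;
  -- putting `u` in front of both gives the claim.
  v≪uv (inj₂ (z , z′ , refl)) qs with p ∷ _ ← Suffixes-++⁻ s qs = ≪-prefix (a ∷ s) p

-- Let s = x ∷ xs. Either s ≪ v already, or s = v ++ s′ and the argument applies again to the shorter suffix s′.
suffix≪power : Suffixes (_≪ (v ++ t)) (x ∷ xs) → 1 ≤ length v → ∀ n → length xs ≤ n →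
               ∃ λ k → (x ∷ xs) ≪ power v k
suffix≪power {v} {t} {x} {xs} ps@(p ∷ _) 1≤v n l = go p
  where
  split : ∀ {s t} v → s ≪ (v ++ t) → s ≪ v ⊎ ∃ λ s′ → s ≡ v ++ s′ × s′ ≪ t
  split []      q         = inj₂ (_ , refl , q)
  split (_ ∷ v) (head≪ q) = inj₁ (head≪ q)
  split (_ ∷ v) (tail≪ q) with split v q
  ... | inj₁ q′              = inj₁ (tail≪ q′)
  ... | inj₂ (s′ , refl , q′) = inj₂ (s′ , refl , q′)

  shorter : ∀ v {s} → x ∷ xs ≡ v ++ y ∷ s → 1 ≤ length v → suc (length s) ≤ length xs
  shorter (_ ∷ v) refl _ = length-suffix v
    where
    length-suffix : ∀ v {y s} → suc (length s) ≤ length (v ++ y ∷ s)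
    length-suffix []      = ≤-refl
    length-suffix (_ ∷ v) = m≤n⇒m≤1+n (length-suffix v)

  go : (x ∷ xs) ≪ (v ++ t) → _
  go p with split v p
  ... | inj₁ q = 1 , ≪-++ʳ q
  ... | inj₂ ([] , _ , ())
  ... | inj₂ (y ∷ s′ , e , q) = rec n (≤-trans (shorter v e 1≤v) l)
    where
    rec : ∀ n → suc (length s′) ≤ n → ∃ λ k → (x ∷ xs) ≪ power v k
    rec (suc n) (s≤s l′) with suffix≪power (Suffixes-++⁻ v (subst (Suffixes _) e ps)) 1≤v n l′
    ... | k , q′ = suc k , subst (_≪ power v (suc k)) (sym e) (≪-prefix v q′)

power-+ : ∀ v k n → power v (k + n) ≡ power v k ++ power v n
power-+ v zero    n = refl
power-+ v (suc k) n = trans (cong (v ++_) (power-+ v k n)) (sym (++-assoc v _ _))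

-- The comparison is decided by a letter within one copy of `u` and `k` copies of `v`, so further
-- copies do not matter.
≪power⇒⪯ : ∀ k → u ≪ power v k → u ⪯ v
-- The bound `suc k` rather than `k` guarantees a copy of `u` to compare.
≪power⇒⪯ {u} {v} k p = suc k , λ where
  (suc b) (s≤s k≤b) → inj₁ (≪⇒<lex (subst (power u (suc b) ≪_)
    (trans (sym (power-+ v k (suc b ∸ k)))
      (cong (power v) (m+[n∸m]≡n (m≤n⇒m≤1+n k≤b))))
    (≪-++ (power u b) (power v (suc b ∸ k)) p)))

≼⇒⪯ : Lyndon u → Lyndon v → u ≼ v → u ⪯ v
≼⇒⪯ {v = v} _ _ (inj₁ p) = ≪power⇒⪯ 1 (≪-++ʳ p)
≼⇒⪯ _ _ (inj₂ (inj₁ refl)) = 0 , λ _ _ → inj₂ refl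
≼⇒⪯ {v = b ∷ t} (lyndon ps) (lyndon _) (inj₂ (inj₂ (z , s , refl)))
  -- One copy of `v` cancels. The rest `z ∷ s` and all its suffixes are proper suffixes of `u`,
  -- hence below `u = v ++ z ∷ s`.
  with k , q ← suffix≪power (Suffixes-++⁻ t ps) (s≤s z≤n) (length s) ≤-refl
  = ≪power⇒⪯ (suc k) (≪-prefix (b ∷ t) q)

-- Lyndon factorization and its singletons

record Factorization (w : Word) : Set where
  constructor factorization
  field
    {factors}  : List Word
    concat≡    : concat factors ≡ w
    allLyndon  : All Lyndon factors
    increasing : Linked _≼_ factors
open Factorization

-- As long as `f ≻ g` for the next factor `g`, the two merge into one Lyndon word, which is then
-- compared with the factor after it.
prepend : ∀ {f fs} → Lyndon f → All Lyndon fs → Linked _≼_ fs → Factorization (f ++ concat fs)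
prepend l [] [] = factorization refl (l ∷ []) [-]
prepend {f} {g ∷ _} l (l′ ∷ ls) p with ≼-or-≻ f g
... | inj₁ f≼g = factorization refl (l ∷ l′ ∷ ls) (f≼g ∷ p)
... | inj₂ f≻g = subst Factorization (++-assoc f g _) (prepend (Lyndon-++ l l′ f≻g) ls (Linked.tail p))

factorize : ∀ w → Factorization w
factorize []      = factorization refl [] []
factorize (x ∷ w) with factorization refl ls p ← factorize w = prepend (lyndon []) ls p

≼⇒Linked⪯ : ∀ {fs} → All Lyndon fs → Linked _≼_ fs → Linked _⪯_ fs
≼⇒Linked⪯ _ []  = []
≼⇒Linked⪯ _ [-] = [-]
≼⇒Linked⪯ (l ∷ ls@(l′ ∷ _)) (p ∷ ps) = ≼⇒⪯ l l′ p ∷ ≼⇒Linked⪯ ls ps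

-- No letter of `y ∷ t` exceeds `a`, and the last one is smaller, because the one-letter suffix `a`
-- would be a prefix of `a ∷ s`. So the run of copies of `a` ends in a descent.
startsDec-Lyndon : ∀ t w → Suffixes (_≪ (a ∷ s)) (y ∷ t) → startsDec (a ∷ (y ∷ t) ++ w) ≡ true
startsDec-Lyndon t w (head≪ y<a ∷ ps) = startsDec-> (t ++ w) y<a
startsDec-Lyndon {a} (x ∷ t) w (tail≪ q ∷ ps) =
  trans (startsDec-≡ a ((x ∷ t) ++ w)) (startsDec-Lyndon t w ps)
startsDec-Lyndon [] w (tail≪ () ∷ ps)

-- Letters below `a` fail the bound, and copies of `a` are decreases by `startsDec-Lyndon`.
records-Lyndon : ∀ t w → Suffixes (_≪ (a ∷ s)) t → records a (t ++ w) ≡ records a w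
records-Lyndon []      w [] = refl
records-Lyndon {a} (x ∷ t) w (head≪ x<a ∷ ps) =
  trans (records-skip a x (t ++ w) (<⇒≤ x<a) (inj₁ x<a)) (records-Lyndon t w ps)
records-Lyndon {a} (a ∷ y ∷ t) w (tail≪ _ ∷ ps) =
  trans (records-skip a a ((y ∷ t) ++ w) ≤-refl (inj₂ (startsDec-Lyndon t w ps)))
        (records-Lyndon (y ∷ t) w ps)
records-Lyndon (x ∷ []) w (tail≪ () ∷ ps)

-- After a single letter `a`, the order `≼` allows only a factor with larger first letter or the
-- letter `a` again, so a run of copies of `a` never ends in a descent.
startsDec-singles : ∀ {fs} → All Lyndon fs → Linked _≼_ ((a ∷ []) ∷ fs) → startsDec (a ∷ concat fs) ≡ false
startsDec-singles [] _ = refl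
startsDec-singles (lyndon {s = s} _ ∷ ls) (inj₁ (head≪ a<b) ∷ ps) = startsDec-< (s ++ _) a<b
startsDec-singles {a} {fs = _ ∷ fs} (l ∷ ls) (inj₂ (inj₁ refl) ∷ ps) =
  trans (startsDec-≡ a (concat fs)) (startsDec-singles ls ps)
startsDec-singles (lyndon {s = []} _ ∷ ls) (inj₂ (inj₂ (_ , _ , ())) ∷ ps)
startsDec-singles (lyndon {s = _ ∷ _} _ ∷ ls) (inj₂ (inj₂ (_ , _ , ())) ∷ ps)

-- A factor of length one is a counted letter. A longer one counts nothing: its first letter is a
-- decrease, and `records-Lyndon` disposes of the others. First letters increase weakly along the
-- factors, so the bound behind a factor is its first letter.
countSingles≡records : ∀ {fs} → All Lyndon fs → Linked _≼_ ((a ∷ s) ∷ fs) → Lyndon (a ∷ s) → m ≤ a →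
                       countSingles ((a ∷ s) ∷ fs) ≡ records m (concat ((a ∷ s) ∷ fs))
countSingles≡records′ : ∀ {fs} → All Lyndon fs → Linked _≼_ ((a ∷ s) ∷ fs) →
                        countSingles fs ≡ records a (concat fs)

countSingles≡records {a} {[]} {m} {fs} ls p l m≤a =
  trans (cong suc (countSingles≡records′ ls p))
        (sym (records-¬dec m a (concat fs) m≤a (startsDec-singles ls p)))
countSingles≡records {a} {y ∷ s} {m} {fs} ls p (lyndon ps) m≤a = begin
  countSingles fs                        ≡⟨ countSingles≡records′ ls p ⟩
  records a (concat fs)                  ≡⟨ records-Lyndon (y ∷ s) (concat fs) ps ⟨
  records a ((y ∷ s) ++ concat fs)       ≡⟨ cong (λ k → records k ((y ∷ s) ++ concat fs)) (m≤n⇒m⊔n≡n m≤a) ⟨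
  records (m ⊔ a) ((y ∷ s) ++ concat fs) ≡⟨ records-dec m a ((y ∷ s) ++ concat fs) (startsDec-Lyndon s (concat fs) ps) ⟨
  records m ((a ∷ y ∷ s) ++ concat fs)   ∎
  where open ≡-Reasoning

countSingles≡records′ [] _ = refl
countSingles≡records′ (l@(lyndon _) ∷ ls) (p ∷ ps) = countSingles≡records ls ps l (≼-head p)

singleIs-records : ∀ w → SingleIs w (records 0 w)
singleIs-records w with factorize w
... | factorization refl ls p = _ , (refl , All.map Lyndon⇒IsLyndon ls , ≼⇒Linked⪯ ls p) , count ls p
  where
  count : ∀ {fs} → All Lyndon fs → Linked _≼_ fs → countSingles fs ≡ records 0 (concat fs)
  count []                  _ = refl
  count (l@(lyndon _) ∷ ls) p = countSingles≡records ls p l z≤n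

-- Inserting V-words

Sorted : Word → Set
Sorted = AllPairs _≤_

sorted? : ∀ w → Dec (Sorted w)
sorted? = allPairs? _≤?_

sorted-∷ : x ≤ y → Sorted (y ∷ s) → Sorted (x ∷ y ∷ s)
sorted-∷ x≤y (p ∷ ps) = (x≤y ∷ All.map (≤-trans x≤y) p) ∷ p ∷ ps

sorted-lower : x ≤ y → Sorted (y ∷ s) → Sorted (x ∷ s)
sorted-lower x≤y (p ∷ ps) = All.map (≤-trans x≤y) p ∷ ps

sorted⇒¬startsDec : Sorted w → startsDec w ≡ false
sorted⇒¬startsDec []             = refl
sorted⇒¬startsDec (_ ∷ [])       = refl
sorted⇒¬startsDec {x ∷ y ∷ s} ((x≤y ∷ _) ∷ p) with m≤n⇒m<n∨m≡n x≤y
... | inj₁ x<y  = startsDec-< s x<y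
... | inj₂ refl = trans (startsDec-≡ x s) (sorted⇒¬startsDec p)

sorted⇒dec≡0 : Sorted w → dec w ≡ 0
sorted⇒dec≡0 [] = refl
sorted⇒dec≡0 (p ∷ ps) rewrite sorted⇒¬startsDec (p ∷ ps) = sorted⇒dec≡0 ps

sorted⇒records≡len : Sorted w → All (m ≤_) w → records m w ≡ len w
sorted⇒records≡len [] _ = refl
sorted⇒records≡len {x ∷ w} {m} (p ∷ ps) (m≤x ∷ _) =
  trans (records-¬dec m x w m≤x (sorted⇒¬startsDec (p ∷ ps))) (cong suc (sorted⇒records≡len ps p))

-- IsV i v: v = y₁ ≥ … ≥ yᵢ > z₁ ≤ … ≤ zₖ with k ≥ 1 and all zⱼ < yᵢ.
data IsV : ℕ → Word → Set where
  one  : Sorted (z ∷ s) → All (_≤ x) (z ∷ s) → IsV 1 (suc x ∷ z ∷ s)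
  more : y ≤ x → IsV i (y ∷ v) → IsV (suc i) (x ∷ y ∷ v)

startsDec-V : ∀ s → IsV i (y ∷ v) → startsDec ((y ∷ v) ++ s) ≡ true
startsDec-V s (one {s = t} _ (z≤x ∷ _)) = startsDec-> (t ++ s) (s≤s z≤x)
startsDec-V s (more {v = v} y≤x p) = startsDec-≥ (v ++ s) y≤x (startsDec-V s p)

¬sorted-V : IsV i v → ¬ Sorted (v ++ s)
¬sorted-V (one _ (z≤x ∷ _)) ((x<z ∷ _) ∷ _) = <⇒≱ x<z z≤x
¬sorted-V (more _ p)        (_ ∷ ps)        = ¬sorted-V p ps

-- v is inserted in front of the longest suffix s of the word such that y ∷ s is sorted, y the first letter of v.
data Ins (i : ℕ) : (v w w′ : Word) → Set where
  here  : IsV i (y ∷ v) → Sorted (y ∷ s) → w ≡ (y ∷ v) ++ s → Ins i (y ∷ v) s w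
  there : Ins i (y ∷ v) w w′ → ¬ Sorted (y ∷ x ∷ w) → Ins i (y ∷ v) (x ∷ w) (x ∷ w′)

ins-total : ∀ w → IsV i v → ∃ (Ins i v w)
ins-total {v = y ∷ v} []      p = _ , here p ([] ∷ []) refl
ins-total {v = y ∷ v} (x ∷ w) p with sorted? (y ∷ x ∷ w)
... | yes q = _ , here p q refl
... | no ¬q = _ , there (proj₂ (ins-total w p)) ¬q

ins-functional : Ins i v w w′ → Ins i v w w″ → w′ ≡ w″
ins-functional (here _ _ refl) (here _ _ refl) = refl
ins-functional (here _ q _)    (there _ ¬q)    = contradiction q ¬q
ins-functional (there _ ¬q)    (here _ q _)    = contradiction q ¬q
ins-functional (there p _)     (there q _)     = cong (_ ∷_) (ins-functional p q)

ins-isV : Ins i v w w′ → IsV i v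
ins-isV (here p _ _) = p
ins-isV (there p _)  = ins-isV p

-- Uniqueness and existence of the last insertion

¬sorted-ins : Ins i v w w′ → ¬ Sorted w′
¬sorted-ins (here p _ refl) = ¬sorted-V p
¬sorted-ins (there p _) (_ ∷ ps) = ¬sorted-ins p ps

split-unique : All (_≤ x) s → All (_≤ x) t → All (x <_) u → All (x <_) v →
               s ++ u ≡ t ++ v → s ≡ t × u ≡ v
split-unique []       []       _        _        e    = refl , e
split-unique []       (p ∷ _)  (q ∷ _)  _        refl = contradiction p (<⇒≱ q)
split-unique (p ∷ _)  []       _        (q ∷ _)  refl = contradiction p (<⇒≱ q)
split-unique (_ ∷ ps) (_ ∷ qs) us       vs       e
  with refl , e′ ← ∷-injective e
  with refl , e″ ← split-unique ps qs us vs e′ = refl , e″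

sorted-++-≤ : Sorted s → All (_≤ x) s → Sorted (x ∷ t) → Sorted (s ++ t)
sorted-++-≤ ps q (t≥x ∷ ts) =
  AllPairs-++⁺ ps ts (All.map (λ z≤x → All.map (≤-trans z≤x) t≥x) q)

-- The falling part ends where the remaining word becomes sorted, which fixes `i`. In that sorted
-- remainder the V-word ends before the first letter that is at least the last letter of the falling
-- part.
V-unique : IsV i (y ∷ v) → IsV j (y ∷ u) → Sorted (y ∷ s) → Sorted (y ∷ t) →
           v ++ s ≡ u ++ t → (i , v , s) ≡ (j , u , t)
V-unique (one ps p) (one qs q) (s> ∷ _) (t> ∷ _) e
  with refl , refl ← split-unique p q s> t> e = refl
V-unique (one ps p) (more _ q) ss _ e =
  contradiction (subst Sorted e (sorted-++-≤ ps (All.map m≤n⇒m≤1+n p) ss)) (¬sorted-V q)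
V-unique (more _ p) (one qs q) _ ts e =
  contradiction (subst Sorted (sym e) (sorted-++-≤ qs (All.map m≤n⇒m≤1+n q) ts)) (¬sorted-V p)
V-unique (more y≤x p) (more z≤x q) ss ts e
  with refl , e′ ← ∷-injective e
  with refl ← V-unique p q (sorted-lower y≤x ss) (sorted-lower z≤x ts) e′ = refl

-- Behind the first letter x of the V-word x ∷ v, the only insertion that yields v ++ s is that of v into s,
-- and it would have continued to the front of x.
V-not-behind : IsV i (x ∷ v) → Sorted (x ∷ s) → Ins j u w (v ++ s) → ¬ Sorted (take 1 u ++ x ∷ w) → ⊥

-- Two insertions at the front agree by `V-unique`, and two behind the same first letter agree by
-- induction; `V-not-behind` excludes the mixed cases.
ins-unique : Ins i v w w″ → Ins j u w′ w″ → (i , v , w) ≡ (j , u , w′)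
ins-unique (here p ss refl) (here q ts e)
  with refl , e′ ← ∷-injective e
  with refl ← V-unique p q ss ts e′ = refl
ins-unique (here p ss refl) (there q ¬t) = contradiction ¬t (V-not-behind p ss q)
ins-unique (there p ¬s) (here q ts refl) = contradiction ¬s (V-not-behind q ts p)
ins-unique (there p _) (there q _) with refl ← ins-unique p q = refl

V-not-behind (one ps p) ss q _ = ¬sorted-ins q (sorted-++-≤ ps (All.map m≤n⇒m≤1+n p) ss)
V-not-behind (more y≤x p) ss q ¬t
  with refl ← ins-unique (here p (sorted-lower y≤x ss) refl) q = ¬t (sorted-∷ y≤x ss)

split-at : ∀ x → Sorted w → ∃₂ λ s t → w ≡ s ++ t × Sorted s × All (_≤ x) s × Sorted (suc x ∷ t)
split-at {w = []}    x []       = [] , [] , refl , [] , [] , [] ∷ []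
split-at {w = y ∷ w} x (p ∷ ps) with y ≤? x
... | no  y≰x = [] , y ∷ w , refl , [] , [] , (sorted-∷ (≰⇒> y≰x) (p ∷ ps))
... | yes y≤x with s , t , refl , ss , s≤x , ts ← split-at x ps =
  y ∷ s , t , refl , ++⁻ˡ s p ∷ ss , y≤x ∷ s≤x , ts

ins-exists : ∀ w″ → ¬ Sorted w″ → ∃ λ i → ∃₂ λ v w → Ins i v w w″
ins-exists []      ¬s = contradiction [] ¬s
ins-exists (x ∷ w) ¬s with sorted? w
... | no ¬s′ with ins-exists w ¬s′
...   | i , y ∷ v , w′ , p with sorted? (y ∷ x ∷ w′)
...     | no ¬q = _ , _ , _ , there p ¬q
-- The V-word read off from the tail would have moved past `x`, so `x` belongs to it and lengthens
-- its falling part.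
ins-exists (x ∷ w) ¬s | no _ | i , y ∷ v , w′ , here p _ refl | yes ((y≤x ∷ _) ∷ q) =
  _ , _ , _ , here (more y≤x p) q refl
-- A V-word that stopped further right cannot move past `x`: dropping `x` from the sorted word would
-- let it pass the letter where it stopped.
ins-exists (x ∷ w) ¬s | no _ | i , y ∷ v , _ , there _ ¬r | yes ((_ ∷ r) ∷ (_ ∷ q)) =
  contradiction (r ∷ q) ¬r
ins-exists (zero ∷ w) ¬s | yes q = contradiction (All.universal (λ _ → z≤n) w ∷ q) ¬s
-- The tail is sorted, so the V-word is the first letter with all smaller letters of the tail; if
-- there are none, the whole word is sorted.
ins-exists (suc x ∷ w) ¬s | yes q with split-at x q
... | []    , t , refl , _  , _ , r = contradiction r ¬s
... | z ∷ s , t , refl , ss , p , r = _ , _ , _ , here (one ss p) r refl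

-- Statistics under insertion

-- Let the V-word land directly behind `x`, before `s`. If `x < y`, then `x` is smaller than its
-- next letter, if any, before and after. If `y ≤ x`, then `x` exceeds the first letter of `s`,
-- since otherwise the V-word would pass `x`; so `x` is a decrease before and after.
ins-startsDec : Ins i (y ∷ v) w w′ → ¬ Sorted (y ∷ x ∷ w) → startsDec (x ∷ w′) ≡ startsDec (x ∷ w)
ins-startsDec {y = y} {v = v} {x = x} (here {s = []} _ _ refl) ¬q with y ≤? x
... | yes y≤x = contradiction (sorted-∷ y≤x ([] ∷ [])) ¬q
... | no  y≰x = startsDec-< (v ++ []) (≰⇒> y≰x)
ins-startsDec {y = y} {v = v} {x = x} (here {s = h ∷ s} p q@((y≤h ∷ _) ∷ hs) refl) ¬q with y ≤? x | x ≤? h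
... | yes y≤x | yes x≤h = contradiction (sorted-∷ y≤x (sorted-∷ x≤h hs)) ¬q
... | yes y≤x | no  x≰h = trans (startsDec-≥ (v ++ h ∷ s) y≤x (startsDec-V (h ∷ s) p))
                                (sym (startsDec-> s (≰⇒> x≰h)))
... | no  y≰x | _       = trans (startsDec-< (v ++ h ∷ s) (≰⇒> y≰x))
                                (sym (startsDec-< s (<-≤-trans (≰⇒> y≰x) y≤h)))
ins-startsDec {x = x} (there {x = h} p ¬r) _ =
  cong (λ b → (h <ᵇ x) ∨ ((h ≤ᵇ x) ∧ b)) (ins-startsDec p ¬r)

dec-V : IsV i (y ∷ v) → Sorted (y ∷ s) → dec ((y ∷ v) ++ s) ≡ i
dec-V {s = s} (one {s = t} ps p) q
  rewrite startsDec-V s (one ps p)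
        | sorted⇒¬startsDec (sorted-++-≤ ps (All.map m≤n⇒m≤1+n p) q) =
  cong suc (sorted⇒dec≡0 (AllPairs.tail (sorted-++-≤ ps (All.map m≤n⇒m≤1+n p) q)))
dec-V {s = s} (more {v = v} y≤x p) q
  rewrite startsDec-V s (more y≤x p) = cong suc (dec-V p (sorted-lower y≤x q))

dec-ins : Ins i v w w′ → dec w′ ≡ i + dec w
dec-ins {i} (here p q refl)
  rewrite sorted⇒dec≡0 (AllPairs.tail q) | +-identityʳ i = dec-V p q
dec-ins {i} {w = x ∷ w} {w′ = x ∷ w′} (there p ¬q) = begin
  d (startsDec (x ∷ w′)) + dec w′ ≡⟨ cong₂ (λ b n → d b + n) (ins-startsDec p ¬q) (dec-ins p) ⟩
  d (startsDec (x ∷ w)) + (i + dec w) ≡⟨ x∙yz≈y∙xz (d (startsDec (x ∷ w))) i (dec w) ⟩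
  i + (d (startsDec (x ∷ w)) + dec w) ∎
  where
  open ≡-Reasoning
  d : Bool → ℕ
  d b = if b then 1 else 0

-- The first letter is at least `x`: its test does not notice `x`, and the maximum with it absorbs
-- `x`.
records-above : ∀ m x → All (x ≤_) w → records (m ⊔ x) w ≡ records m w
records-above m x [] = refl
records-above {h ∷ w} m x (x≤h ∷ _) = cong₂ (λ b k → (if b ∧ not (startsDec (h ∷ w)) then 1 else 0) + records k w)
  test (trans (⊔-assoc m x h) (cong (m ⊔_) (m≤n⇒m⊔n≡n x≤h)))
  where
  test : (m ⊔ x ≤ᵇ h) ≡ (m ≤ᵇ h)
  test with m ≤? h
  ... | yes m≤h = trans (dec-true (m ⊔ x ≤? h) (⊔-lub m≤h x≤h)) (sym (dec-true (m ≤? h) m≤h))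
  ... | no  m≰h = trans (dec-false (m ⊔ x ≤? h) (λ q → m≰h (≤-trans (m≤m⊔n m x) q))) (sym (dec-false (m ≤? h) m≰h))

records-below : ∀ {m} s → All (_< m) t → records m (t ++ s) ≡ records m s
records-below s [] = refl
records-below {x ∷ t} {m} s (x<m ∷ p) =
  trans (records-skip m x (t ++ s) (<⇒≤ x<m) (inj₁ x<m)) (records-below s p)

-- The falling letters are decreases, and the rising ones lie below the bound that the falling ones
-- leave behind.
records-V : ∀ m s → IsV i (y ∷ v) → records m ((y ∷ v) ++ s) ≡ records (m ⊔ y) s
records-V m s (one {z} {t} {x} ps p) =
  trans (records-dec m (suc x) ((z ∷ t) ++ s) (startsDec-V s (one ps p)))
        (records-below s (All.map (λ z≤x → ≤-trans (s≤s z≤x) (m≤n⊔m m (suc x))) p))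
records-V m s (more {y} {x} {v = v} y≤x p) = begin
  records m ((x ∷ y ∷ v) ++ s)     ≡⟨ records-dec m x ((y ∷ v) ++ s) (startsDec-V s (more y≤x p)) ⟩
  records (m ⊔ x) ((y ∷ v) ++ s)   ≡⟨ records-V (m ⊔ x) s p ⟩
  records (m ⊔ x ⊔ y) s            ≡⟨ cong (λ k → records k s) (m≥n⇒m⊔n≡m (≤-trans y≤x (m≤n⊔m m x))) ⟩
  records (m ⊔ x) s                ∎
  where open ≡-Reasoning

records-ins : ∀ m → Ins i v w w′ → records m w′ ≡ records m w
-- The V-word only raises the bound to `y`, and all letters behind it are at least `y`.
records-ins m (here {y = y} {s = s} p (q ∷ _) refl) = trans (records-V m s p) (records-above m y q)
records-ins m (there {x = x} p ¬q) =
  cong₂ (λ b k → (if (m ≤ᵇ x) ∧ not b then 1 else 0) + k) (ins-startsDec p ¬q) (records-ins (m ⊔ x) p)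

tot-ins : Ins i v w w′ → tot w′ ≡ tot v + tot w
tot-ins (here {y = y} {v} {s} _ _ refl) = sum-++ (y ∷ v) s
tot-ins {v = v} {w = x ∷ w} (there p _) = trans (cong (x +_) (tot-ins p)) (x∙yz≈y∙xz x (tot v) (tot w))

len-ins : Ins i v w w′ → len w′ ≡ len v + len w
len-ins (here {y = y} {v} {s} _ _ refl) = length-++ (y ∷ v)
len-ins {v = v} {w = x ∷ w} (there p _) = trans (cong suc (len-ins p)) (sym (+-suc (len v) (len w)))

ins-longer : Ins i v w w′ → len w < len w′
ins-longer (here {y = y} {v} {s} _ _ refl) = s≤s (subst (len s ≤_) (sym (length-++ v)) (m≤n+m (len s) (len v)))
ins-longer (there p _) = s≤s (ins-longer p)

All-ins⁺ : ∀ {P : ℕ → Set} → Ins i v w w′ → All P v → All P w → All P w′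
All-ins⁺ (here _ _ refl) ps qs       = ++⁺ ps qs
All-ins⁺ (there i _)     ps (q ∷ qs) = q ∷ All-ins⁺ i ps qs

All-ins⁻ : ∀ {P : ℕ → Set} → Ins i v w w′ → All P w′ → All P v × All P w
All-ins⁻ (here {y = y} {v = v} _ _ refl) ps = ++⁻ (y ∷ v) ps
All-ins⁻ (there i _) (p ∷ ps) with qs , rs ← All-ins⁻ i ps = qs , p ∷ rs

-- V-words as elements of D(r)

NonIncreasing : Word → Set
NonIncreasing = AllPairs _≥_

All-reverse : ∀ {P : ℕ → Set} → All P w → All P (reverse w)
All-reverse {w} = All-resp-↭ (↭-sym (↭-reverse w))

AllPairs-reverse : ∀ {R S : ℕ → ℕ → Set} → (∀ {x y} → R x y → S y x) → AllPairs R w → AllPairs S (reverse w)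
AllPairs-reverse f [] = []
AllPairs-reverse {x ∷ w} f (p ∷ ps) rewrite unfold-reverse x w =
  AllPairs-++⁺ (AllPairs-reverse f ps) ([] ∷ []) (All.map (λ r → f r ∷ []) (All-reverse p))

tot-reverse : ∀ w → tot (reverse w) ≡ tot w
tot-reverse w = sum-↭ (↭-reverse w)

-- Adding one to the first `i` letters makes the step to letter `i + 1` strict, so the turning point
-- can be recognized.
vWord : ℕ → Word → Word
vWord zero    w       = reverse w
-- A default value: the index of an element of D(r) is smaller than the length of its word.
vWord (suc i) []      = []
vWord (suc i) (x ∷ w) = suc x ∷ vWord i w

vWord-isV : NonIncreasing w → 1 ≤ i → suc i ≤ len w → IsV i (vWord i w)
vWord-isV {i = suc (suc i)} ((y≤x ∷ _) ∷ ps@(_ ∷ _)) _ (s≤s l) = more (s≤s y≤x) (vWord-isV ps (s≤s z≤n) l)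
vWord-isV {w = x ∷ w@(_ ∷ _)} {i = 1} (p ∷ ps) _ _
  with reverse w | length-reverse w | AllPairs-reverse (λ r → r) ps | All-reverse p
... | []    | () | _ | _
... | _ ∷ _ | _  | q | q′ = one q q′
vWord-isV {i = 1} ([] ∷ []) _ (s≤s ())

len-vWord : ∀ i w → len (vWord i w) ≡ len w
len-vWord zero    w       = length-reverse w
len-vWord (suc i) []      = refl
len-vWord (suc i) (x ∷ w) = cong suc (len-vWord i w)

tot-vWord : ∀ i w → i ≤ len w → tot (vWord i w) ≡ i + tot w
tot-vWord zero    w       _       = tot-reverse w
tot-vWord (suc i) (x ∷ w) (s≤s l) = cong suc (trans (cong (x +_) (tot-vWord i w l)) (x∙yz≈y∙xz x i (tot w)))

vWord-≤ : ∀ i → All (_< r) w → All (_≤ r) (vWord i w)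
vWord-≤ zero    ps       = All-reverse (All.map <⇒≤ ps)
vWord-≤ (suc i) []       = []
vWord-≤ (suc i) (p ∷ ps) = p ∷ vWord-≤ i ps

vWord-injective : ∀ i {w w′} → i ≤ len w → i ≤ len w′ → vWord i w ≡ vWord i w′ → w ≡ w′
vWord-injective zero    _       _       e = reverse-injective e
vWord-injective (suc i) {x ∷ w} {x′ ∷ w′} (s≤s l) (s≤s l′) e
  with refl , e′ ← ∷-injective e = cong (x ∷_) (vWord-injective i l l′ e′)

vWord-surjective : IsV i v → All (_≤ r) v →
                   ∃ λ w → All (_< r) w × NonIncreasing w × 1 ≤ i × suc i ≤ len w × vWord i w ≡ v
vWord-surjective (one {z} {s} {x} ps p) (x<r ∷ _) =
  x ∷ reverse (z ∷ s) ,
  x<r ∷ All-reverse (All.map (λ z≤x → ≤-<-trans z≤x x<r) p) ,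
  All-reverse p ∷ AllPairs-reverse (λ r → r) ps ,
  s≤s z≤n ,
  s≤s (subst (1 ≤_) (sym (length-reverse (z ∷ s))) (s≤s z≤n)) ,
  cong (suc x ∷_) (reverse-involutive (z ∷ s))
vWord-surjective (more {x = x} y≤x p) (x≤r ∷ qs) with vWord-surjective p qs
-- The next letter is a successor by induction, so the larger first letter is one as well and can be
-- lowered.
vWord-surjective (more {x = suc x} (s≤s y≤x) p) (x<r ∷ qs)
  | y ∷ w , w<r , ps@(y≥ ∷ _) , s≤s _ , l , refl =
  x ∷ y ∷ w , x<r ∷ w<r , (y≤x ∷ All.map (λ z≤y → ≤-trans z≤y y≤x) y≥) ∷ ps , s≤s z≤n , s≤s l , refl

vOf : DElt r → Word
vOf d = vWord (idx d) (word d)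

idx<len : (d : DElt r) → suc (idx d) ≤ len (word d)
idx<len (delt (_ ∷ _) _ _ _ _ _ l) = s≤s l

vOf-isV : (d : DElt r) → IsV (idx d) (vOf d)
vOf-isV d = vWord-isV (Linked⇒AllPairs (flip ≤-trans) (nonincr d)) (idx≥1 d) (idx<len d)

delt-≡ : {d e : DElt r} → idx d ≡ idx e → word d ≡ word e → d ≡ e
delt-≡ {d = delt w p q l i k m} {e = delt w p′ q′ l′ i k′ m′} refl refl
  rewrite All.irrelevant <-irrelevant p p′ | Linked.irrelevant ≤-irrelevant q q′
        | ≤-irrelevant l l′ | ≤-irrelevant k k′ | ≤-irrelevant m m′ = refl

vOf-injective : (d e : DElt r) → idx d ≡ idx e → vOf d ≡ vOf e → d ≡ e
vOf-injective d@(delt _ _ _ _ i _ _) e@(delt _ _ _ _ .i _ _) refl p =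
  delt-≡ refl (vWord-injective i (<⇒≤ (idx<len d)) (<⇒≤ (idx<len e)) p)

vOf-surjective : IsV i v → All (_≤ r) v → ∃ λ (d : DElt r) → idx d ≡ i × vOf d ≡ v
vOf-surjective p q with vWord-surjective p q
... | w@(_ ∷ _) , w<r , ps , 1≤i , s≤s l , e =
  delt w w<r (AllPairs⇒Linked ps) (s≤s (≤-trans 1≤i l)) _ 1≤i l , refl , e

-- Words built by successive insertions

-- The graph of the map. The head of the list is inserted last, so undoing the last insertion
-- removes the head.
data Built {r : ℕ} (w₀ : Word) : List (DElt r) → Word → Set where
  []  : Built w₀ [] (reverse w₀)
  _∷_ : ∀ {d : DElt r} {ds} → Ins (idx d) (vOf d) w w′ → Built w₀ ds w → Built w₀ (d ∷ ds) w′

private variable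
  w₀ w₁ : Word
  ds es : List (DElt r)

built-total : ∀ w₀ (ds : List (DElt r)) → ∃ (Built w₀ ds)
built-total w₀ []       = _ , []
built-total w₀ (d ∷ ds) with w , b ← built-total w₀ ds = _ , proj₂ (ins-total w (vOf-isV d)) ∷ b

built-functional : Built w₀ ds w → Built w₀ ds w′ → w ≡ w′
built-functional []      []      = refl
built-functional (p ∷ b) (q ∷ c) with refl ← built-functional b c = ins-functional p q

built-sorted : NonIncreasing w₀ → Sorted (reverse w₀)
built-sorted = AllPairs-reverse (λ r → r)

-- A sorted word admits no last insertion, so both lists end together; otherwise `ins-unique`
-- identifies the heads and the words before the insertion.
built-injective : {ds es : List (DElt r)} → NonIncreasing w₀ → NonIncreasing w₁ →
                  Built w₀ ds w → Built w₁ es w′ → w ≡ w′ → w₀ ≡ w₁ × ds ≡ es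
built-injective p q []      []      e    = reverse-injective e , refl
built-injective p q []      (i ∷ _) refl = contradiction (built-sorted p) (¬sorted-ins i)
built-injective p q (i ∷ _) []      refl = contradiction (built-sorted q) (¬sorted-ins i)
built-injective p q (_∷_ {d = d} i b) (_∷_ {d = e} j c) refl
  with u ← ins-unique i j
  with refl ← vOf-injective d e (cong proj₁ u) (cong (λ t → proj₁ (proj₂ t)) u)
  with eq , refl ← built-injective p q b c (cong (λ t → proj₂ (proj₂ t)) u) = eq , refl

-- Insertions are undone until the word is sorted; each shortens the word, so induction on the
-- length bound `n` terminates.
built-surjective : ∀ n w → len w < n → All (_≤ r) w →
                   ∃₂ λ w₀ (ds : List (DElt r)) → All (_≤ r) w₀ × NonIncreasing w₀ × Built w₀ ds w
built-surjective (suc n) w (s≤s l) ps with sorted? w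
... | yes s = reverse w , [] , All-reverse ps , AllPairs-reverse (λ r → r) s ,
              subst (Built _ []) (reverse-involutive w) []
... | no ¬s with ins-exists w ¬s
...   | i , v , w′ , p with All-ins⁻ p ps
...     | vs , ws with vOf-surjective (ins-isV p) vs | built-surjective n w′ (≤-trans (ins-longer p) l) ws
...       | d , refl , refl | w₀ , ds , p₀ , q , b = w₀ , d ∷ ds , p₀ , q , p ∷ b

built-len : Built w₀ ds w → len w ≡ len w₀ + sum (map (λ d → len (word d)) ds)
built-len {w₀} [] = trans (length-reverse w₀) (sym (+-identityʳ (len w₀)))
built-len {w₀} (_∷_ {d = d} p b) =
  trans (len-ins p) (trans (cong₂ _+_ (len-vWord (idx d) (word d)) (built-len b))
                           (x∙yz≈y∙xz (len (word d)) (len w₀) _))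

built-≤ : All (_≤ r) w₀ → {ds : List (DElt r)} → Built w₀ ds w → All (_≤ r) w
built-≤ ps [] = All-reverse ps
built-≤ ps (_∷_ {d = d} i b) = All-ins⁺ i (vWord-≤ (idx d) (letters d)) (built-≤ ps b)

built-dec : NonIncreasing w₀ → Built w₀ ds w → sum (map idx ds) ≡ dec w
built-dec ps []      = sym (sorted⇒dec≡0 (built-sorted ps))
built-dec ps (_∷_ {d = d} i b) = trans (cong (idx d +_) (built-dec ps b)) (sym (dec-ins i))

built-tot : Built w₀ ds w → sum (map idx ds) + tot w₀ + sum (map (λ e → tot (word e)) ds) ≡ tot w
built-tot {w₀} [] = trans (+-identityʳ (tot w₀)) (sym (tot-reverse w₀))
built-tot {w₀} {ds = _ ∷ ds} (_∷_ {w = w} {w′ = w′} {d = d} p b) = begin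
  k + K + tot w₀ + (h + H)   ≡⟨ regroup k K (tot w₀) h H ⟩
  (k + h) + (K + tot w₀ + H) ≡⟨ cong₂ _+_ (sym (tot-vWord k (word d) (<⇒≤ (idx<len d)))) (built-tot b) ⟩
  tot (vOf d) + tot w        ≡⟨ tot-ins p ⟨
  tot w′                     ∎
  where
  open ≡-Reasoning
  k K h H : ℕ
  k = idx d
  K = sum (map idx ds)
  h = tot (word d)
  H = sum (map (λ e → tot (word e)) ds)
  regroup : ∀ k K c h H → k + K + c + (h + H) ≡ (k + h) + (K + c + H)
  regroup = solve-∀

built-records : NonIncreasing w₀ → Built w₀ ds w → records 0 w ≡ len w₀
built-records {w₀} ps [] =
  trans (sorted⇒records≡len (built-sorted ps) (All.universal (λ _ → z≤n) _)) (length-reverse w₀)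
built-records ps (p ∷ b) = trans (records-ins 0 p) (built-records ps b)

-- The bijection and its statistics

theorem2p1 : (r n : ℕ) →
    Σ (Dstar n r ⤖ W n r) (λ φ → (d : Dstar n r) →
    sum (map idx (proj₁ (proj₂ d))) ≡ dec (proj₁ (Bijection.to φ d))
    × sum (map idx (proj₁ (proj₂ d))) + tot (proj₁ (proj₁ d)) + sum (map (λ e → tot (word e)) (proj₁ (proj₂ d))) ≡ tot (proj₁ (Bijection.to φ d))
    × SingleIs (proj₁ (Bijection.to φ d)) (len (proj₁ (proj₁ d))))
theorem2p1 r n = mk⤖ (φ-injective , strictlySurjective⇒surjective φ-surjective) , statistics
  where
  φ : Dstar n r → W n r
  φ ((w₀ , p , _) , ds , e) with w , b ← built-total w₀ ds = w , trans (built-len b) e , built-≤ p b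

  W-≡ : {w w′ : W n r} → proj₁ w ≡ proj₁ w′ → w ≡ w′
  W-≡ {w , l , p} {_ , l′ , p′} refl
    rewrite ≡-irrelevant l l′ | All.irrelevant ≤-irrelevant p p′ = refl

  Dstar-≡ : {d d′ : Dstar n r} → proj₁ (proj₁ d) ≡ proj₁ (proj₁ d′) × proj₁ (proj₂ d) ≡ proj₁ (proj₂ d′) → d ≡ d′
  Dstar-≡ {(_ , p , q) , _ , e} {(_ , p′ , q′) , _ , e′} (refl , refl)
    rewrite ≡-irrelevant e e′ | All.irrelevant ≤-irrelevant p p′ | Linked.irrelevant ≤-irrelevant q q′ = refl

  φ-injective : ∀ {d d′} → φ d ≡ φ d′ → d ≡ d′
  φ-injective {(w₀ , _ , q) , ds , _} {(w₁ , _ , q′) , es , _} e = Dstar-≡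
    (built-injective (Linked⇒AllPairs (flip ≤-trans) q) (Linked⇒AllPairs (flip ≤-trans) q′)
      (proj₂ (built-total w₀ ds)) (proj₂ (built-total w₁ es)) (cong proj₁ e))

  φ-surjective : ∀ w → ∃ λ d → φ d ≡ w
  φ-surjective (w , l , p) with w₀ , ds , p₀ , q , b ← built-surjective (suc (len w)) w ≤-refl p =
    ((w₀ , p₀ , AllPairs⇒Linked q) , ds , trans (sym (built-len b)) l) ,
    W-≡ (built-functional (proj₂ (built-total w₀ ds)) b)

  statistics : (d : Dstar n r) →
    sum (map idx (proj₁ (proj₂ d))) ≡ dec (proj₁ (φ d))
    × sum (map idx (proj₁ (proj₂ d))) + tot (proj₁ (proj₁ d)) + sum (map (λ e → tot (word e)) (proj₁ (proj₂ d))) ≡ tot (proj₁ (φ d))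
    × SingleIs (proj₁ (φ d)) (len (proj₁ (proj₁ d)))
  statistics ((w₀ , _ , q) , ds , _) with w , b ← built-total w₀ ds = built-dec ps b , built-tot b ,
    subst (SingleIs w) (built-records ps b) (singleIs-records w)
    where
    ps : NonIncreasing w₀
    ps = Linked⇒AllPairs (flip ≤-trans) q
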